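{- Let $v$ be any vertex of $G$ (defined in the context), with base point $p$. Then the three pairs of $v$ can be written (choosing which element of each unordered pair is called $q_i$ and which $r_i$) as $v=(p,q_ar_a,q_br_b,q_cr_c)$ in such a way that the 4 copies of $K_4$ in $G$ containing $v$ are exactly $\langle q_aq_bq_c\rangle$, $\langle q_ar_br_c\rangle$, $\langle r_aq_br_c\rangle$, $\langle r_ar_bq_c\rangle$; moreover the 3 copies of $K_{2,2,2}$ in $G$ containing $v$ are exactly $[pq_ar_a]_a$, $[pq_br_b]_b$, $[pq_cr_c]_c$.
   Context: The Fano plane $\mathcal F$ has points $1,\dots,7$ and lines $\{1,2,3\},\{1,4,5\},\{1,6,7\},\{2,4,6\},\{2,5,7\},\{3,4,7\},\{3,5,6\}$. For a point $p$, the three lines through $p$ are $\{p,q,r\}$ for three disjoint pairs $\{q,r\}$ partitioning $\mathcal F\setminus\{p\}$. An ordered pencil through $p$ is a tuple $v=(p,q_ar_a,q_br_b,q_cr_c)$ in which $q_ar_a,q_br_b,q_cr_c$ are these three (unordered) pairs listed in a chosen linear order (positions $a<b<c$). The graph $G$ has the 42 ordered pencils as vertices, with $v=(p,q_ar_a,q_br_b,q_cr_c)$ and $v'=(p',q'_ar'_a,q'_br'_b,q'_cr'_c)$ adjacent iff $p\neq p'$ and $|\{q_i,r_i\}\cap\{q'_i,r'_i\}|=1$ for each $i\in\{a,b,c\}$. A copy of $H$ in $G$ is an induced subgraph isomorphic to $H$. For an ordered Fano line $xyz$ (a line $\{x,y,z\}$ of $\mathcal F$ with its points in a chosen order), $\langle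 xyz\rangle$ denotes the subgraph of $G$ induced by the 4 vertices $(p,q_ar_a,q_br_b,q_cr_c)$ with $p\notin\{x,y,z\}$, $x\in\{q_a,r_a\}$, $y\in\{q_b,r_b\}$, $z\in\{q_c,r_c\}$ (one for each such $p$); it is a copy of $K_4$. For a (unordered) Fano line $xyz$ and position $j\in\{a,b,c\}$, $[xyz]_j$ denotes the subgraph of $G$ induced by the 6 ordered pencils whose base point lies in $\{x,y,z\}$ and whose $j$-th line is $\{x,y,z\}$; it is a copy of $K_{2,2,2}$. -}

module Defs where

open import Data.Bool using (Bool; true; false; T; _∧_; _∨_; not; if_then_else_)
open import Data.Nat using (ℕ; _/_; _+_)
open import Data.Fin using (Fin; zero; suc; toℕ; _≟_)
open import Data.Product using (Σ; ∃; ∃-syntax; _×_; _,_; proj₁; proj₂)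
open import Data.Sum using (_⊎_)
open import Data.Vec using (Vec; []; _∷_; lookup)
open import Data.List using (List; []; _∷_)
open import Data.Bool.ListAction using (any)
open import Relation.Nullary using (¬_)
open import Relation.Nullary.Decidable using (⌊_⌋)
open import Relation.Binary.PropositionalEquality using (_≡_; _≢_)
open import Function.Definitions using (Injective)

-- The Fano plane.  Points 1,…,7 of the paper are Fin 7 elements 0,…,6
-- (paper point k ↦ Fin element k-1).

Point : Set
Point = Fin 7

_==_ : Point → Point → Bool
x == y = ⌊ x ≟ y ⌋

fanoLines : List (Point × Point × Point)
fanoLines =
  (# 0 , # 1 , # 2) ∷ (# 0 , # 3 , # 4) ∷ (# 0 , # 5 , # 6) ∷
  (# 1 , # 3 , # 5) ∷ (# 1 , # 4 , # 6) ∷ (# 2 , # 3 , # 6) ∷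
  (# 2 , # 4 , # 5) ∷ []
  where open import Data.Fin using (#_)

memB : Point → Point × Point × Point → Bool
memB x (a , b , c) = (x == a) ∨ (x == b) ∨ (x == c)

isLineB : Point → Point → Point → Bool
isLineB x y z =
  not (x == y) ∧ not (x == z) ∧ not (y == z) ∧
  any (λ L → memB x L ∧ memB y L ∧ memB z L) fanoLines

IsLine : Point → Point → Point → Set
IsLine x y z = T (isLineB x y z)

_∈₃_ : Point → Point × Point × Point → Set
w ∈₃ (x , y , z) = (w ≡ x) ⊎ (w ≡ y) ⊎ (w ≡ z)

-- Ordered pencils.  An unordered pair {q,r} is stored canonically as
-- (q , r) with q < r.  Positions a<b<c are Fin 3 = 0,1,2.

record RawPencil : Set where
  constructor mkRaw
  field
    base  : Point
    pairs : Vec (Point × Point) 3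
open RawPencil public

_<B_ : Point → Point → Bool
x <B y = toℕ x Data.Nat.<ᵇ toℕ y

disjB : Point × Point → Point × Point → Bool
disjB (q , r) (q' , r') =
  not (q == q') ∧ not (q == r') ∧ not (r == q') ∧ not (r == r')

pairOkB : Point → Point × Point → Bool
pairOkB p (q , r) = (q <B r) ∧ isLineB p q r

-- (p, q₀r₀, q₁r₁, q₂r₂) is an ordered pencil through p: each {p,qᵢ,rᵢ}
-- is a line and the three pairs are pairwise disjoint (hence they are
-- the three lines through p, partitioning F ∖ {p}, in some order).
isPencilB : RawPencil → Bool
isPencilB (mkRaw p (P₀ ∷ P₁ ∷ P₂ ∷ [])) =
  pairOkB p P₀ ∧ pairOkB p P₁ ∧ pairOkB p P₂ ∧
  disjB P₀ P₁ ∧ disjB P₀ P₂ ∧ disjB P₁ P₂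

V : Set
V = Σ RawPencil (λ r → T (isPencilB r))

pt : V → Point
pt v = base (proj₁ v)

pair : V → Fin 3 → Point × Point
pair v i = lookup (pairs (proj₁ v)) i

-- |{q,r} ∩ {q',r'}|  (q ≠ r)
common : Point × Point → Point × Point → ℕ
common (q , r) (q' , r') =
  (if (q == q') ∨ (q == r') then 1 else 0) +
  (if (r == q') ∨ (r == r') then 1 else 0)

Adj : V → V → Set
Adj v w = (pt v ≢ pt w) × (∀ i → common (pair v i) (pair w i) ≡ 1)

VSet : Set₁
VSet = V → Set

_≐_ : VSet → VSet → Set
S ≐ S' = ∀ w → (S w → S' w) × (S' w → S w)

record Copy (n : ℕ) (HAdj : Fin n → Fin n → Set) : Set where
  field
    emb : Fin n → V
    inj : Injective _≡_ _≡_ emb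
    iso : ∀ i j → (Adj (emb i) (emb j) → HAdj i j) × (HAdj i j → Adj (emb i) (emb j))
open Copy public

verts : ∀ {n H} → Copy n H → VSet
verts c w = ∃[ i ] (emb c i ≡ w)

IsCopy : (n : ℕ) → (Fin n → Fin n → Set) → VSet → Set
IsCopy n H S = Σ (Copy n H) (λ c → verts c ≐ S)

CopiesThroughAre : (n : ℕ) → (Fin n → Fin n → Set) → V → {m : ℕ} → Vec VSet m → Set
CopiesThroughAre n H v Xs =
  (∀ k → IsCopy n H (lookup Xs k) × lookup Xs k v) ×
  (∀ (c : Copy n H) → verts c v → ∃[ k ] (verts c ≐ lookup Xs k)) ×
  (∀ k l → lookup Xs k ≐ lookup Xs l → k ≡ l)

K4Adj : Fin 4 → Fin 4 → Set
K4Adj i j = i ≢ j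

K222Adj : Fin 6 → Fin 6 → Set
K222Adj i j = toℕ i / 2 ≢ toℕ j / 2

⟨_,_,_⟩ : Point → Point → Point → VSet
⟨ x , y , z ⟩ w =
  IsLine x y z × ¬ (pt w ∈₃ (x , y , z)) ×
  (x ∈₂ pair w zero) × (y ∈₂ pair w (suc zero)) × (z ∈₂ pair w (suc (suc zero)))
  where
  _∈₂_ : Point → Point × Point → Set
  t ∈₂ (q , r) = (t ≡ q) ⊎ (t ≡ r)

[_,_,_]at_ : Point → Point → Point → Fin 3 → VSet
([ x , y , z ]at j) w =
  IsLine x y z × (pt w ∈₃ (x , y , z)) ×
  (proj₁ (pair w j) ∈₃ (x , y , z)) × (proj₂ (pair w j) ∈₃ (x , y , z))

qq : V → (Fin 3 → Bool) → Fin 3 → Point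
qq v s i = if s i then proj₂ (pair v i) else proj₁ (pair v i)

rr : V → (Fin 3 → Bool) → Fin 3 → Point
rr v s i = if s i then proj₁ (pair v i) else proj₂ (pair v i)

{-# OPTIONS --safe #-}
module Submission where

-- G has only 42 vertices, so its local structure is settled by exhaustive search: every clique
-- u v w t lies in one of the four sets ⟨…⟩ of u, every octahedron with a pole u lies in one of
-- the three sets […] of u, and such a set of u is contained in such a set of each of its
-- members.  Hence a copy through v, whatever the position of v in it, lies in one of the
-- listed sets; these are copies of the same size, so an injectivity argument gives equality.

open import Defs
open import Data.Bool using (Bool; T; not; false)
open import Data.Bool.Properties using (T-irrelevant; T-∧)
open import Data.Fin using (Fin; zero; suc; _≟_; punchOut)
open import Data.Fin.Patterns using (0F; 1F; 2F; 3F; 4F; 5F; 6F)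
open import Data.Fin.Properties using (any?; all?; punchOut-injective; injective⇒≤)
open import Data.List using (List; []; _∷_; _++_; map; filter)
import Data.List.Membership.DecPropositional as DecMembership
open import Data.List.Membership.Propositional using (_∈_)
open import Data.List.Membership.Propositional.Properties using (∈-filter⁺; ∈-map⁻)
open import Data.List.Relation.Unary.All as All using (All)
open import Data.Nat using (ℕ; suc)
import Data.Nat.Properties as ℕ
open import Data.Product using (Σ; ∃-syntax; _×_; _,_; proj₁; proj₂; map₂)
import Data.Product.Properties as Product
open import Data.Vec using (Vec; []; _∷_; lookup)
import Data.Vec.Properties as Vec
open import Function.Base using (_∘_)
open import Function.Bundles using (Equivalence)
open import Function.Definitions using (Injective)
open import Relation.Binary.PropositionalEquality
  using (_≡_; _≢_; refl; sym; trans; cong; subst)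
open import Relation.Nullary using (¬_; Dec; yes; no; contradiction)
open import Relation.Nullary.Decidable
  using (T?; map′; toWitness; ¬?; _×-dec_; _⊎-dec_; _→-dec_)
open import Relation.Unary using (Decidable)

-- Enumeration of the vertices.

orders : (p : Point) (P Q R : Point × Point) →
  {T (isPencilB (mkRaw p (P ∷ Q ∷ R ∷ [])))} → {T (isPencilB (mkRaw p (P ∷ R ∷ Q ∷ [])))} →
  {T (isPencilB (mkRaw p (Q ∷ P ∷ R ∷ [])))} → {T (isPencilB (mkRaw p (Q ∷ R ∷ P ∷ [])))} →
  {T (isPencilB (mkRaw p (R ∷ P ∷ Q ∷ [])))} → {T (isPencilB (mkRaw p (R ∷ Q ∷ P ∷ [])))} →
  List V
orders p P Q R {t₁} {t₂} {t₃} {t₄} {t₅} {t₆} =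
  (mkRaw p (P ∷ Q ∷ R ∷ []) , t₁) ∷ (mkRaw p (P ∷ R ∷ Q ∷ []) , t₂) ∷
  (mkRaw p (Q ∷ P ∷ R ∷ []) , t₃) ∷ (mkRaw p (Q ∷ R ∷ P ∷ []) , t₄) ∷
  (mkRaw p (R ∷ P ∷ Q ∷ []) , t₅) ∷ (mkRaw p (R ∷ Q ∷ P ∷ []) , t₆) ∷ []

-- At closed points each implicit argument `T (isPencilB _)` of `orders` computes to the unit type
-- and is filled in by eta. Vertices with the same base point are consecutive, which
-- `octa-enumerated` relies on.
vertices : List V
vertices =
  orders 0F (1F , 2F) (3F , 4F) (5F , 6F) ++
  orders 1F (0F , 2F) (3F , 5F) (4F , 6F) ++
  orders 2F (0F , 1F) (3F , 6F) (4F , 5F) ++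
  orders 3F (0F , 4F) (1F , 5F) (2F , 6F) ++
  orders 4F (0F , 3F) (1F , 6F) (2F , 5F) ++
  orders 5F (0F , 6F) (1F , 3F) (2F , 4F) ++
  orders 6F (0F , 5F) (1F , 4F) (2F , 3F)

_≟ᴿ_ : (r r′ : RawPencil) → Dec (r ≡ r′)
mkRaw p Ps ≟ᴿ mkRaw q Qs =
  map′ (λ { (refl , refl) → refl }) (λ { refl → refl , refl })
    (p ≟ q ×-dec Vec.≡-dec (Product.≡-dec _≟_ _≟_) Ps Qs)

V-≡ : {v w : V} → proj₁ v ≡ proj₁ w → v ≡ w
V-≡ {r , _} refl = cong (r ,_) (T-irrelevant {isPencilB r} _ _)

_≟ⱽ_ : (v w : V) → Dec (v ≡ w)
v ≟ⱽ w = map′ V-≡ (cong proj₁) (proj₁ v ≟ᴿ proj₁ w)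

open DecMembership _≟ᴿ_ using (_∈?_)

∀pair? : {P : Point × Point → Set} → Decidable P → Dec (∀ q r → P (q , r))
∀pair? P? = all? λ q → all? λ r → P? (q , r)

abstract
  -- Each `pairOkB` premise precedes the quantifiers over the later pairs, so the search drops a bad
  -- pair at once instead of running over all triples of pairs.
  pencil-listed : ∀ p q₀ r₀ → T (pairOkB p (q₀ , r₀)) → ∀ q₁ r₁ → T (pairOkB p (q₁ , r₁)) →
    ∀ q₂ r₂ → T (isPencilB (mkRaw p ((q₀ , r₀) ∷ (q₁ , r₁) ∷ (q₂ , r₂) ∷ []))) →
    mkRaw p ((q₀ , r₀) ∷ (q₁ , r₁) ∷ (q₂ , r₂) ∷ []) ∈ map proj₁ vertices
  pencil-listed = toWitness {a? =
    all? λ p → ∀pair? λ P₀ → T? (pairOkB p P₀) →-dec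
    ∀pair? λ P₁ → T? (pairOkB p P₁) →-dec ∀pair? λ P₂ →
    T? (isPencilB (mkRaw p (P₀ ∷ P₁ ∷ P₂ ∷ []))) →-dec
    mkRaw p (P₀ ∷ P₁ ∷ P₂ ∷ []) ∈? map proj₁ vertices} _

∈-vertices : ∀ v → v ∈ vertices
∈-vertices (mkRaw p (P₀ ∷ P₁ ∷ P₂ ∷ []) , t)
  with t₀ , t′ ← Equivalence.to (T-∧ {pairOkB p P₀}) t
  with t₁ , _ ← Equivalence.to (T-∧ {pairOkB p P₁}) t′
  with w , w∈ , eq ← ∈-map⁻ proj₁ (pencil-listed p _ _ t₀ _ _ t₁ _ _ t)
  = subst (_∈ vertices) (V-≡ (sym eq)) w∈

∀V? : {P : V → Set} → Decidable P → Dec (∀ v → P v)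
∀V? P? = map′ (λ ps v → All.lookup ps (∈-vertices v)) (λ f → All.universal f vertices)
  (All.all? P? vertices)

-- Decidable adjacency and the listed sets.

adj? : ∀ v w → Dec (Adj v w)
adj? v w = ¬? (pt v ≟ pt w) ×-dec all? λ i → common (pair v i) (pair w i) ℕ.≟ 1

-- The lines avoiding pt v meet each of the three pairs once, and which choices of points give
-- lines is a parity condition; so exchanging q and r in the first pair is all that is needed.
signs : V → Fin 3 → Bool
signs v 0F      = not (isLineB (proj₁ (pair v 0F)) (proj₁ (pair v 1F)) (proj₁ (pair v 2F)))
signs v (suc _) = false

quads : V → Vec VSet 4
quads v =
  ⟨ qq v s 0F , qq v s 1F , qq v s 2F ⟩ ∷
  ⟨ qq v s 0F , rr v s 1F , rr v s 2F ⟩ ∷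
  ⟨ rr v s 0F , qq v s 1F , rr v s 2F ⟩ ∷
  ⟨ rr v s 0F , rr v s 1F , qq v s 2F ⟩ ∷ []
  where s = signs v

octas : V → Vec VSet 3
octas v =
  [ pt v , qq v s 0F , rr v s 0F ]at 0F ∷
  [ pt v , qq v s 1F , rr v s 1F ]at 1F ∷
  [ pt v , qq v s 2F , rr v s 2F ]at 2F ∷ []
  where s = signs v

∈₃? : ∀ t L → Dec (t ∈₃ L)
∈₃? t (x , y , z) = t ≟ x ⊎-dec t ≟ y ⊎-dec t ≟ z

⟨⟩? : ∀ x y z → Decidable ⟨ x , y , z ⟩
⟨⟩? x y z w = T? (isLineB x y z) ×-dec ¬? (∈₃? (pt w) (x , y , z)) ×-dec
  at? x 0F ×-dec at? y 1F ×-dec at? z 2F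
  where
  at? : ∀ t i → Dec _
  at? t i = t ≟ proj₁ (pair w i) ⊎-dec t ≟ proj₂ (pair w i)

[]at? : ∀ x y z j → Decidable ([ x , y , z ]at j)
[]at? x y z j w = T? (isLineB x y z) ×-dec ∈₃? (pt w) (x , y , z) ×-dec
  ∈₃? (proj₁ (pair w j)) (x , y , z) ×-dec ∈₃? (proj₂ (pair w j)) (x , y , z)

quad? : ∀ v k → Decidable (lookup (quads v) k)
quad? v 0F = ⟨⟩? _ _ _
quad? v 1F = ⟨⟩? _ _ _
quad? v 2F = ⟨⟩? _ _ _
quad? v 3F = ⟨⟩? _ _ _

octa? : ∀ v j → Decidable (lookup (octas v) j)
octa? v 0F = []at? _ _ _ _
octa? v 1F = []at? _ _ _ _
octa? v 2F = []at? _ _ _ _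

K4Adj? : ∀ i j → Dec (K4Adj i j)
K4Adj? i j = ¬? (i ≟ j)

K222Adj? : ∀ i j → Dec (K222Adj i j)
K222Adj? i j = ¬? (_ ℕ.≟ _)

-- Finite checks on the listed sets.

module _ {n : ℕ} {H : Fin n → Fin n → Set} where

  -- Fixing the embedding `e` in `IsCopy` leaves only quantifiers over finite types, so the property
  -- can be decided.
  EnumeratesCopy : VSet → (Fin n → V) → Set
  EnumeratesCopy S e =
    (∀ i j → e i ≡ e j → i ≡ j) ×
    (∀ i j → (Adj (e i) (e j) → H i j) × (H i j → Adj (e i) (e j))) ×
    (∀ i → S (e i)) × (∀ w → S w → ∃[ i ] e i ≡ w)

  isCopy : ∀ {S e} → EnumeratesCopy S e → IsCopy n H S
  isCopy {S} {e} (inj , iso , sound , complete) =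
    record { emb = e ; inj = inj _ _ ; iso = iso } ,
    λ w → (λ { (i , eq) → subst S eq (sound i) }) , complete w

  enumeratesCopy? : (∀ i j → Dec (H i j)) → ∀ {S} → Decidable S → ∀ e → Dec (EnumeratesCopy S e)
  enumeratesCopy? H? S? e =
    (all? λ i → all? λ j → e i ≟ⱽ e j →-dec i ≟ j) ×-dec
    (all? λ i → all? λ j →
      (adj? (e i) (e j) →-dec H? i j) ×-dec (H? i j →-dec adj? (e i) (e j))) ×-dec
    (all? λ i → S? (e i)) ×-dec
    ∀V? λ w → S? w →-dec any? λ i → e i ≟ⱽ w

_⊆ᵛ_ : VSet → VSet → Set
S ⊆ᵛ S′ = ∀ w → S w → S′ w

⊆ᵛ? : ∀ {S S′} → Decidable S → Decidable S′ → Dec (S ⊆ᵛ S′)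
⊆ᵛ? S? S′? = ∀V? λ w → S? w →-dec S′? w

-- Junk value: indices past the end of the list give d.
nth : ∀ {n} → V → List V → Fin n → V
nth d []       _       = d
nth d (x ∷ _)  zero    = x
nth d (_ ∷ xs) (suc i) = nth d xs i

members : ∀ {S : VSet} → Decidable S → List V
members S? = filter S? vertices

abstract
  quad-enumerated : ∀ v k →
    EnumeratesCopy {H = K4Adj} (lookup (quads v) k) (nth v (members (quad? v k)))
  quad-enumerated = toWitness {a? = ∀V? λ v → all? λ k →
    enumeratesCopy? K4Adj? (quad? v k) (nth v (members (quad? v k)))} _

  -- `K222Adj` makes `2m` and `2m+1` non-adjacent. Each point of the line is the base of two
  -- members, non-adjacent because they share it; these are consecutive after filtering `vertices`,
  -- so the numbering fits.
  octa-enumerated : ∀ v j →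
    EnumeratesCopy {H = K222Adj} (lookup (octas v) j) (nth v (members (octa? v j)))
  octa-enumerated = toWitness {a? = ∀V? λ v → all? λ j →
    enumeratesCopy? K222Adj? (octa? v j) (nth v (members (octa? v j)))} _

  quad-self : ∀ v k → lookup (quads v) k v
  quad-self = toWitness {a? = ∀V? λ v → all? λ k → quad? v k v} _

  octa-self : ∀ v j → lookup (octas v) j v
  octa-self = toWitness {a? = ∀V? λ v → all? λ j → octa? v j v} _

  quad-distinct : ∀ v k l → lookup (quads v) k ⊆ᵛ lookup (quads v) l → k ≡ l
  quad-distinct = toWitness {a? = ∀V? λ v → all? λ k → all? λ l →
    ⊆ᵛ? (quad? v k) (quad? v l) →-dec k ≟ l} _

  octa-distinct : ∀ v j l → lookup (octas v) j ⊆ᵛ lookup (octas v) l → j ≡ l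
  octa-distinct = toWitness {a? = ∀V? λ v → all? λ j → all? λ l →
    ⊆ᵛ? (octa? v j) (octa? v l) →-dec j ≟ l} _

  -- `⟨ x , y , z ⟩` depends on the ordered line alone. Each pair of a member `v` contains one of
  -- its points, and `quads v` runs over all ordered lines formed in that way.
  quad-transfer : ∀ u k v → lookup (quads u) k v →
    ∃[ l ] lookup (quads u) k ⊆ᵛ lookup (quads v) l
  quad-transfer = toWitness {a? = ∀V? λ u → all? λ k → ∀V? λ v → quad? u k v →-dec
    any? λ l → ⊆ᵛ? (quad? u k) (quad? v l)} _

  -- All members share the `j`-th line, so the `j`-th set of `v` is the same set.
  octa-transfer : ∀ u j v → lookup (octas u) j v →
    ∃[ l ] lookup (octas u) j ⊆ᵛ lookup (octas v) l
  octa-transfer = toWitness {a? = ∀V? λ u → all? λ j → ∀V? λ v → octa? u j v →-dec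
    any? λ l → ⊆ᵛ? (octa? u j) (octa? v l)} _

-- Local search for cliques and octahedra.

nbrs : V → List V → List V
nbrs v = filter (adj? v)

opposites : V → List V → List V
opposites v = filter λ w → ¬? (v ≟ⱽ w) ×-dec ¬? (adj? v w)

-- Neighbour lists are passed as arguments so that the type checker evaluates them only once.

CliquesAt : V → List V → Set
CliquesAt u N = All (λ v → CliquesOn (nbrs v N) v) N
  where
  CliquesOn : List V → V → Set
  CliquesOn N′ v = All (λ w → All (λ t →
    ∃[ k ] let S = lookup (quads u) k in S u × S v × S w × S t) (nbrs w N′)) N′

cliquesAt? : ∀ u N → Dec (CliquesAt u N)
cliquesAt? u N = All.all? (λ v → cliquesOn? v (nbrs v N)) N
  where
  cliquesOn? : ∀ v N′ → Dec (All _ N′)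
  cliquesOn? v N′ = All.all? (λ w → All.all? (λ t → any? λ k →
    quad? u k u ×-dec quad? u k v ×-dec quad? u k w ×-dec quad? u k t) (nbrs w N′)) N′

-- An octahedron is a pole u, an equator v w s t (in cyclic order), and the pole x opposite to u.
OctahedraAt : V → (N L : List V) → Set
OctahedraAt u N L = All (λ v → EquatorsAt v (nbrs v N) (nbrs v L)) N
  where
  EquatorsAt : V → List V → List V → Set
  EquatorsAt v N′ M = All (λ s → EquatorsOn s (nbrs s N′)) (opposites v N)
    where
    EquatorsOn : V → List V → Set
    EquatorsOn s C = All (λ w → All (λ t → All (λ x →
      ∃[ j ] let S = lookup (octas u) j in S u × S x × S v × S s × S w × S t)
      (opposites u (nbrs t (nbrs w (nbrs s M))))) (opposites w C)) C

octahedraAt? : ∀ u N L → Dec (OctahedraAt u N L)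
octahedraAt? u N L = All.all? (λ v → equatorsAt? v (nbrs v N) (nbrs v L)) N
  where
  equatorsAt? : ∀ v (N′ M : List V) → Dec _
  equatorsAt? v N′ M = All.all? (λ s → equatorsOn? s (nbrs s N′)) (opposites v N)
    where
    equatorsOn? : ∀ s C → Dec _
    equatorsOn? s C = All.all? (λ w → All.all? (λ t → All.all? (λ x →
      any? λ j → octa? u j u ×-dec octa? u j x ×-dec octa? u j v ×-dec
                 octa? u j s ×-dec octa? u j w ×-dec octa? u j t)
      (opposites u (nbrs t (nbrs w (nbrs s M))))) (opposites w C)) C

abstract
  cliques : ∀ u → CliquesAt u (nbrs u vertices)
  cliques = toWitness {a? = ∀V? λ u → cliquesAt? u (nbrs u vertices)} _

  -- The pole opposite to `u` is not a neighbour of `u`, so its candidates come from a second list,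
  -- the full `vertices`.
  octahedra : ∀ u → OctahedraAt u (nbrs u vertices) vertices
  octahedra = toWitness {a? = ∀V? λ u → octahedraAt? u (nbrs u vertices) vertices} _

∈-nbrs : ∀ v {w N} → w ∈ N → Adj v w → w ∈ nbrs v N
∈-nbrs v = ∈-filter⁺ (adj? v)

∈-opposites : ∀ v {w N} → w ∈ N → v ≢ w → ¬ Adj v w → w ∈ opposites v N
∈-opposites v w∈N v≢w v≁w = ∈-filter⁺ (λ w → ¬? (v ≟ⱽ w) ×-dec ¬? (adj? v w)) w∈N (v≢w , v≁w)

lookup-clique : ∀ u v w t {N} → CliquesAt u N → v ∈ N → w ∈ N → t ∈ N →
  Adj v w → Adj v t → Adj w t →
  ∃[ k ] let S = lookup (quads u) k in S u × S v × S w × S t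
lookup-clique u v w t {N} cs v∈ w∈ t∈ vw vt wt =
  All.lookup (All.lookup (All.lookup cs v∈) (∈-nbrs v w∈ vw)) (∈-nbrs w (∈-nbrs v t∈ vt) wt)

lookup-octahedron : ∀ u x v s w t {N L} → OctahedraAt u N L →
  v ∈ N → s ∈ N → w ∈ N → t ∈ N → x ∈ L →
  v ≢ s → ¬ Adj v s → w ≢ t → ¬ Adj w t → u ≢ x → ¬ Adj u x →
  Adj v w → Adj v t → Adj s w → Adj s t → Adj v x → Adj s x → Adj w x → Adj t x →
  ∃[ j ] let S = lookup (octas u) j in S u × S x × S v × S s × S w × S t
lookup-octahedron u x v s w t os v∈ s∈ w∈ t∈ x∈
    v≢s v≁s w≢t w≁t u≢x u≁x vw vt sw st vx sx wx tx =
  -- The lookups follow the nesting of the search: `v`, its antipode `s`, then `w`, its antipode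
  -- `t`, and finally `x`.
  All.lookup (All.lookup (All.lookup (All.lookup (All.lookup os v∈)
    (∈-opposites v s∈ v≢s v≁s))
    (∈-nbrs s (∈-nbrs v w∈ vw) sw))
    (∈-opposites w (∈-nbrs s (∈-nbrs v t∈ vt) st) w≢t w≁t))
    (∈-opposites u (∈-nbrs t (∈-nbrs w (∈-nbrs s (∈-nbrs v x∈ vx) sx) wx) tx) u≢x u≁x)

-- Feeding an arbitrary copy to the search.

module _ {n : ℕ} {H : Fin n → Fin n → Set} (c : Copy n H) where

  adj : ∀ i j → H i j → Adj (emb c i) (emb c j)
  adj i j = proj₂ (iso c i j)

  nonadj : ∀ i j → ¬ H i j → ¬ Adj (emb c i) (emb c j)
  nonadj i j ¬h a = ¬h (proj₁ (iso c i j) a)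

  distinct : ∀ i j → i ≢ j → emb c i ≢ emb c j
  distinct i j i≢j = i≢j ∘ inj c

  nbr : ∀ i j → H i j → emb c j ∈ nbrs (emb c i) vertices
  nbr i j h = ∈-nbrs (emb c i) (∈-vertices (emb c j)) (adj i j h)

every₄ : (P : Fin 4 → Set) → P 0F × P 1F × P 2F × P 3F → ∀ i → P i
every₄ P (a , b , c , d) = λ where
  0F → a
  1F → b
  2F → c
  3F → d

every₆ : (P : Fin 6 → Set) → P 0F × P 1F × P 2F × P 3F × P 4F × P 5F → ∀ i → P i
every₆ P (a , b , rest) = λ where
  0F            → a
  1F            → b
  (suc (suc i)) → every₄ (λ k → P (suc (suc k))) rest i

K4-rooted : (c : Copy 4 K4Adj) → ∃[ k ] ∀ i → lookup (quads (emb c 0F)) k (emb c i)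
K4-rooted c =
  map₂ (λ {k} → every₄ (λ i → lookup (quads (emb c 0F)) k (emb c i))) (lookup-clique
    (emb c 0F) (emb c 1F) (emb c 2F) (emb c 3F)
    {N = nbrs (emb c 0F) vertices} (cliques (emb c 0F))
    (nbr c 0F 1F λ ()) (nbr c 0F 2F λ ()) (nbr c 0F 3F λ ())
    (adj c 1F 2F λ ()) (adj c 1F 3F λ ()) (adj c 2F 3F λ ()))

-- The antipodal pairs of `K222Adj` are 0 1, 2 3 and 4 5. Hence 0 and 1 serve as poles, with the
-- equator 2, 4, 3, 5 in cyclic order.
K222-rooted : (c : Copy 6 K222Adj) → ∃[ j ] ∀ i → lookup (octas (emb c 0F)) j (emb c i)
K222-rooted c =
  map₂ (λ {j} → every₆ (λ i → lookup (octas (emb c 0F)) j (emb c i))) (lookup-octahedron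
    (emb c 0F) (emb c 1F) (emb c 2F) (emb c 3F) (emb c 4F) (emb c 5F)
    {N = nbrs (emb c 0F) vertices} {L = vertices} (octahedra (emb c 0F))
    (nbr c 0F 2F λ ()) (nbr c 0F 3F λ ())
    (nbr c 0F 4F λ ()) (nbr c 0F 5F λ ()) (∈-vertices (emb c 1F))
    (distinct c 2F 3F λ ()) (nonadj c 2F 3F λ ≢ → ≢ refl)
    (distinct c 4F 5F λ ()) (nonadj c 4F 5F λ ≢ → ≢ refl)
    (distinct c 0F 1F λ ()) (nonadj c 0F 1F λ ≢ → ≢ refl)
    (adj c 2F 4F λ ()) (adj c 2F 5F λ ())
    (adj c 3F 4F λ ()) (adj c 3F 5F λ ())
    (adj c 2F 1F λ ()) (adj c 3F 1F λ ())
    (adj c 4F 1F λ ()) (adj c 5F 1F λ ()))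

-- Counting, and the classification of copies through a vertex.

injective⇒surjective : ∀ {n} {f : Fin n → Fin n} → Injective _≡_ _≡_ f → ∀ j → ∃[ i ] f i ≡ j
injective⇒surjective {suc n} {f} f-inj j with any? (λ i → f i ≟ j)
... | yes p = p
-- If `f` misses `j`, deleting `j` from the codomain gives an injection of `Fin (suc n)` into
-- `Fin n`.
... | no ¬p = contradiction (injective⇒≤ avoid-inj) ℕ.1+n≰n
  where
  missed : ∀ i → j ≢ f i
  missed i eq = ¬p (i , sym eq)
  avoid-inj : Injective _≡_ _≡_ λ i → punchOut (missed i)
  avoid-inj eq = f-inj (punchOut-injective (missed _) (missed _) eq)

module _ {n : ℕ} {H : Fin n → Fin n → Set} where

  -- Sending each index of `c` to the index of the same vertex in the copy on `S` is an injective
  -- self-map of `Fin n`, hence surjective, so `c` reaches all of `S`.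
  ⊆⇒≐ : ∀ {S} → IsCopy n H S → (c : Copy n H) → (∀ i → S (emb c i)) → verts c ≐ S
  ⊆⇒≐ {S} (c′ , c′≐S) c c⊆S w = (λ { (i , eq) → subst S eq (c⊆S i) }) , onto
    where
    g : Fin n → Fin n
    g i = proj₁ (proj₂ (c′≐S (emb c i)) (c⊆S i))
    g-emb : ∀ i → emb c′ (g i) ≡ emb c i
    g-emb i = proj₂ (proj₂ (c′≐S (emb c i)) (c⊆S i))
    g-inj : Injective _≡_ _≡_ g
    g-inj eq = inj c (trans (sym (g-emb _)) (trans (cong (emb c′) eq) (g-emb _)))
    onto : S w → verts c w
    onto w∈S
      with j , eq ← proj₂ (c′≐S w) w∈S
      with i , gi≡j ← injective⇒surjective g-inj j
      = i , trans (sym (g-emb i)) (trans (cong (emb c′) gi≡j) eq)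

  -- Serves both graphs. The last hypothesis may root the set at any vertex `u`; the transfer
  -- hypothesis re-roots it at `v`.
  copiesThrough : ∀ {m} (X : V → Vec VSet m) →
    (∀ v k → IsCopy n H (lookup (X v) k)) →
    (∀ v k → lookup (X v) k v) →
    (∀ v k l → lookup (X v) k ⊆ᵛ lookup (X v) l → k ≡ l) →
    (∀ u k v → lookup (X u) k v → ∃[ l ] lookup (X u) k ⊆ᵛ lookup (X v) l) →
    ((c : Copy n H) → ∃[ u ] ∃[ k ] ∀ i → lookup (X u) k (emb c i)) →
    ∀ v → CopiesThroughAre n H v (X v)
  copiesThrough X copy self distinct transfer contained v =
    (λ k → copy v k , self v k) , classify , λ k l k≐l → distinct v k l (proj₁ ∘ k≐l)
    where
    classify : ∀ c → verts c v → ∃[ l ] verts c ≐ lookup (X v) l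
    classify c (i , eq)
      with u , k , c⊆S ← contained c
      with l , S⊆S′ ← transfer u k v (subst (lookup (X u) k) eq (c⊆S i))
      = l , ⊆⇒≐ (copy v l) c (λ i → S⊆S′ _ (c⊆S i))

theorem4p2 : (v : V) → Σ (Fin 3 → Bool) (λ s →
    CopiesThroughAre 4 K4Adj v
    (⟨ qq v s zero , qq v s (suc zero) , qq v s (suc (suc zero)) ⟩ ∷
    ⟨ qq v s zero , rr v s (suc zero) , rr v s (suc (suc zero)) ⟩ ∷
    ⟨ rr v s zero , qq v s (suc zero) , rr v s (suc (suc zero)) ⟩ ∷
    ⟨ rr v s zero , rr v s (suc zero) , qq v s (suc (suc zero)) ⟩ ∷ [])
    ×
    CopiesThroughAre 6 K222Adj v
    ([ pt v , qq v s zero , rr v s zero ]at zero ∷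
    [ pt v , qq v s (suc zero) , rr v s (suc zero) ]at (suc zero) ∷
    [ pt v , qq v s (suc (suc zero)) , rr v s (suc (suc zero)) ]at (suc (suc zero)) ∷ []))
theorem4p2 v = signs v ,
  copiesThrough quads (λ v k → isCopy (quad-enumerated v k)) quad-self quad-distinct
    quad-transfer (λ c → emb c 0F , K4-rooted c) v ,
  copiesThrough octas (λ v j → isCopy (octa-enumerated v j)) octa-self octa-distinct
    octa-transfer (λ c → emb c 0F , K222-rooted c) v
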